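{- For every $N \in \mathbb{N}$ there exists a finite set $A \subset \mathbb{N}$ with $|A| \geq N$ such that $$s_+(A) \ll |A|^{1/2}\log |A| \quad\text{and}\quad s_*(A) \ll |A|^{2/3},$$ where the implied constants are absolute (in particular independent of $N$). In particular, $\max\{s_+(A), s_*(A)\} \ll |A|^{2/3}$.
   Context: A set $S \subset \mathbb{R}$ is a (additive) Sidon set if the only solutions to $a+b=c+d$ with $a,b,c,d\in S$ are the trivial ones, i.e. those with $\{a,b\}=\{c,d\}$. A set $S \subset \mathbb{R}$ is a multiplicative Sidon set if the only solutions to $ab=cd$ with $a,b,c,d \in S$ are those with $\{a,b\}=\{c,d\}$. For a finite set $A\subset\mathbb{R}$, $s_+(A)$ denotes the size of the largest Sidon set $A'\subset A$, and $s_*(A)$ denotes the size of the largest multiplicative Sidon set $A' \subset A$. For positive quantities, $X \ll Y$ means $X \leq C Y$ for some absolute constant $C>0$. The logarithm is the natural logarithm. -}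

module Defs where

open import Algebra.Core using (Op₂)
open import Algebra.Definitions.RawSemiring using (_^_)
open import Data.Integer.Base as ℤ using (+_; +≤+)
import Data.Integer.Properties as ℤ
open import Data.List.Base using (List; []; _∷_; _++_; length; map; filter; foldr; applyUpTo)
open import Data.List.Extrema.Nat using (max)
open import Data.List.Membership.Propositional using (_∈_)
open import Data.List.Relation.Unary.All as All using (All; all?)
open import Data.Nat.Base as ℕ using (ℕ; zero; suc)
import Data.Nat.Properties as ℕ
import Data.Nat.Coprimality as ℕ
open import Data.Product.Base using (∃-syntax; _×_; _,_; proj₁; proj₂)
open import Data.Rational.Base using (ℚ; mkℚ; 0ℚ; 1ℚ; 1/_; _/_; _+_; _*_; _≤_; _<_; *≤*; nonNegative; +-*-rawSemiring)
import Data.Rational.Properties as ℚ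
open import Data.Sum.Base using (_⊎_; inj₁; inj₂; [_,_]′)
open import Function.Base using (_∘_)
open import Relation.Binary.Definitions using (tri<; tri≈; tri>)
open import Relation.Binary.PropositionalEquality using (_≡_; refl; sym; trans; cong; cong₂)
open import Relation.Nullary using (¬_; contradiction)
open import Relation.Nullary.Decidable using (map′; _→-dec_; _×-dec_; _⊎-dec_)
open import Relation.Unary using (Pred; Decidable)
open import Level using (0ℓ)

-- {a , b} = {c , d} as sets.
SamePair : (a b c d : ℕ) → Set
SamePair a b c d = (a ≡ c × b ≡ d) ⊎ (a ≡ d × b ≡ c)

IsSidon : Op₂ ℕ → List ℕ → Set
IsSidon _∙_ S = ∀ {a b c d} → a ∈ S → b ∈ S → c ∈ S → d ∈ S →
                a ∙ b ≡ c ∙ d → SamePair a b c d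

isSidon? : ∀ _∙_ → Decidable (IsSidon _∙_)
isSidon? _∙_ S = map′
  (λ h a∈ b∈ c∈ d∈ → All.lookup (All.lookup (All.lookup (All.lookup h a∈) b∈) c∈) d∈)
  (λ h → All.tabulate λ a∈ → All.tabulate λ b∈ → All.tabulate λ c∈ → All.tabulate λ d∈ → h a∈ b∈ c∈ d∈)
  (all? (λ a → all? (λ b → all? (λ c → all? (λ d →
    ((a ∙ b) ℕ.≟ (c ∙ d)) →-dec
    (((a ℕ.≟ c) ×-dec (b ℕ.≟ d)) ⊎-dec ((a ℕ.≟ d) ×-dec (b ℕ.≟ c)))) S) S) S) S)

-- A finite set A is a list without repetitions; its subsets are its 2^|A|
-- sublists, each listed in the order inherited from A.
subsets : List ℕ → List (List ℕ)
subsets []      = [] ∷ []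
subsets (x ∷ A) = subsets A ++ map (x ∷_) (subsets A)

-- The default value 0 of the maximum is harmless: the empty set is Sidon.
maxSidon : Op₂ ℕ → List ℕ → ℕ
maxSidon _∙_ A = max 0 (map length (filter (isSidon? _∙_) (subsets A)))

s₊ s⁎ : List ℕ → ℕ
s₊ = maxSidon ℕ._+_
s⁎ = maxSidon ℕ._*_

-- Dedekind cuts in the one-sided form: a real x ≥ 0 is the set of the
-- rationals q < x.  This set contains all negative rationals, is not all
-- of ℚ, is downward closed, and has no greatest element.
record ℝ≥0 : Set₁ where
  field
    _∋_     : Pred ℚ 0ℓ
    neg     : ∀ {q} → q < 0ℚ → _∋_ q
    proper  : ∃[ q ] ¬ _∋_ q
    down    : ∀ {p q} → p < q → _∋_ q → _∋_ p
    rounded : ∀ {p} → _∋_ p → ∃[ q ] p < q × _∋_ q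

open ℝ≥0 public using (_∋_)

infix 4 _≤ᵣ_ _<ᵣ_

_≤ᵣ_ : ℝ≥0 → ℝ≥0 → Set
x ≤ᵣ y = ∀ {q} → x ∋ q → y ∋ q

_<ᵣ_ : ℝ≥0 → ℝ≥0 → Set
x <ᵣ y = ∃[ q ] ¬ (x ∋ q) × y ∋ q

<⇒≱ : ∀ {p q} → p < q → ¬ (q ≤ p)
<⇒≱ p<q q≤p = ℚ.<-irrefl refl (ℚ.<-≤-trans p<q q≤p)

-- The supremum of P ∪ {0}, for a set of rationals P bounded above.
sup : (P : Pred ℚ 0ℓ) → (∃[ B ] 0ℚ ≤ B × (∀ {r} → P r → r ≤ B)) → ℝ≥0
sup P (B , 0≤B , P≤B) = record
  { _∋_     = _∋′_
  ; neg     = inj₁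
  ; proper  = B , [ (λ B<0 → <⇒≱ B<0 0≤B) , (λ (r , r∈P , B<r) → <⇒≱ B<r (P≤B r∈P)) ]′
  ; down    = λ p<q → [ inj₁ ∘ ℚ.<-trans p<q , (λ (r , r∈P , q<r) → inj₂ (r , r∈P , ℚ.<-trans p<q q<r)) ]′
  ; rounded = [ (λ p<0 → let q , p<q , q<0 = ℚ.<-dense p<0 in q , p<q , inj₁ q<0)
              , (λ (r , r∈P , p<r) → let q , p<q , q<r = ℚ.<-dense p<r in q , p<q , inj₂ (r , r∈P , q<r))
              ]′
  }
  where
  _∋′_ : Pred ℚ 0ℓ
  _∋′_ q = q < 0ℚ ⊎ (∃[ r ] P r × q < r)

∉⇒upperBound : ∀ x {q} → ¬ (x ∋ q) → ∀ {p} → x ∋ p → p ≤ q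
∉⇒upperBound x {q} q∉x {p} p∈x with ℚ.<-cmp p q
... | tri< p<q _ _ = ℚ.<⇒≤ p<q
... | tri≈ _ p≡q _ = ℚ.≤-reflexive p≡q
... | tri> _ _ q<p = contradiction (ℝ≥0.down x q<p p∈x) q∉x

*-mono-≤-nonNeg : ∀ {p q r s} → 0ℚ ≤ r → 0ℚ ≤ q → p ≤ q → r ≤ s → p * r ≤ q * s
*-mono-≤-nonNeg {p} {q} {r} {s} 0≤r 0≤q p≤q r≤s = ℚ.≤-trans
  (ℚ.*-monoʳ-≤-nonNeg r {{nonNegative 0≤r}} p≤q)
  (ℚ.*-monoˡ-≤-nonNeg q {{nonNegative 0≤q}} r≤s)

0≤* : ∀ {p q} → 0ℚ ≤ p → 0ℚ ≤ q → 0ℚ ≤ p * q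
0≤* {p} {q} 0≤p 0≤q = ℚ.nonNegative⁻¹ (p * q)
  {{ℚ.nonNeg*nonNeg⇒nonNeg p {{nonNegative 0≤p}} q {{nonNegative 0≤q}}}}

infixl 7 _*ᵣ_

_*ᵣ_ : ℝ≥0 → ℝ≥0 → ℝ≥0
x *ᵣ y = sup
  (λ r → ∃[ a ] ∃[ b ] 0ℚ ≤ a × 0ℚ ≤ b × x ∋ a × y ∋ b × r ≡ a * b)
  (X * Y , 0≤* 0≤X 0≤Y , λ { (a , b , 0≤a , 0≤b , a∈x , b∈y , refl) →
    *-mono-≤-nonNeg 0≤b 0≤X (∉⇒upperBound x X∉x a∈x) (∉⇒upperBound y Y∉y b∈y) })
  where
  X = proj₁ (ℝ≥0.proper x)
  Y = proj₁ (ℝ≥0.proper y)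
  X∉x = proj₂ (ℝ≥0.proper x)
  Y∉y = proj₂ (ℝ≥0.proper y)
  0≤X : 0ℚ ≤ X
  0≤X = ℚ.≮⇒≥ (X∉x ∘ ℝ≥0.neg x)
  0≤Y : 0ℚ ≤ Y
  0≤Y = ℚ.≮⇒≥ (Y∉y ∘ ℝ≥0.neg y)

fromℕ : ℕ → ℚ
fromℕ n = mkℚ (+ n) 0 (ℕ.sym (ℕ.1-coprimeTo n))

fromℕ-mono : ∀ {m n} → m ℕ.≤ n → fromℕ m ≤ fromℕ n
fromℕ-mono m≤n = *≤* (ℤ.*-monoʳ-≤-nonNeg (+ 1) (+≤+ m≤n))

0≤fromℕ : ∀ n → 0ℚ ≤ fromℕ n
0≤fromℕ n = fromℕ-mono {0} {n} ℕ.z≤n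

ofℕ : ℕ → ℝ≥0
ofℕ n = sup (_≡ fromℕ n) (fromℕ n , 0≤fromℕ n , ℚ.≤-reflexive)

0ᵣ : ℝ≥0
0ᵣ = ofℕ 0

infixr 8 _^ℚ_

_^ℚ_ : ℚ → ℕ → ℚ
_^ℚ_ = _^_ +-*-rawSemiring

1≤^ : ∀ {r} → 1ℚ ≤ r → ∀ k → 1ℚ ≤ r ^ℚ k
1≤^ 1≤r zero    = ℚ.≤-refl
1≤^ {r} 1≤r (suc k) = *-mono-≤-nonNeg {1ℚ} {r} {1ℚ} (0≤fromℕ 1) (ℚ.≤-trans (0≤fromℕ 1) 1≤r) 1≤r (1≤^ 1≤r k)

≤-root : ∀ {r} k n → r ^ℚ (suc k) ≤ fromℕ n → r ≤ fromℕ (suc n)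
≤-root {r} k n rᵏ≤n with ℚ.≤-total r 1ℚ
... | inj₁ r≤1 = ℚ.≤-trans r≤1 (fromℕ-mono {1} {suc n} (ℕ.s≤s ℕ.z≤n))
... | inj₂ 1≤r = begin
  r              ≡⟨ ℚ.*-identityʳ r ⟨
  r * 1ℚ         ≤⟨ ℚ.*-monoˡ-≤-nonNeg r {{nonNegative (ℚ.≤-trans (0≤fromℕ 1) 1≤r)}} (1≤^ 1≤r k) ⟩
  r * r ^ℚ k     ≤⟨ rᵏ≤n ⟩
  fromℕ n        ≤⟨ fromℕ-mono (ℕ.n≤1+n n) ⟩
  fromℕ (suc n)  ∎
  where open ℚ.≤-Reasoning

-- n ^[ a / b ] is n^(a/b), the nonnegative b-th root of n^a.
infix 8 _^[_/_]

_^[_/_] : ℕ → ℕ → (b : ℕ) → .{{ℕ.NonZero b}} → ℝ≥0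
n ^[ a / suc k ] = sup
  (λ r → 0ℚ ≤ r × r ^ℚ suc k ≤ fromℕ (n ℕ.^ a))
  (fromℕ (suc (n ℕ.^ a)) , 0≤fromℕ (suc (n ℕ.^ a)) , λ (_ , rᵏ≤nᵃ) → ≤-root k (n ℕ.^ a) rᵏ≤nᵃ)

-- The lower Riemann sum of ∫₁ⁿ dt/t for the partition of [1 , n] into
-- (n - 1) m intervals of length 1/m: the i-th interval (i from 0) has right
-- endpoint (m + i + 1)/m, so it contributes (1/m) · m/(m + i + 1).
logSum : ℕ → ℕ → ℚ
logSum n m = foldr _+_ 0ℚ (applyUpTo (λ i → 1/ fromℕ (suc (m ℕ.+ i))) ((n ℕ.∸ 1) ℕ.* m))

fromℕ≡/1 : ∀ n → fromℕ n ≡ + n / 1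
fromℕ≡/1 n = sym (ℚ.normalize-coprime (ℕ.sym (ℕ.1-coprimeTo n)))

fromℕ-homo-+ : ∀ m n → fromℕ (m ℕ.+ n) ≡ fromℕ m + fromℕ n
fromℕ-homo-+ m n = trans (fromℕ≡/1 (m ℕ.+ n))
  (cong₂ (λ i j → (i ℤ.+ j) / 1) (sym (ℤ.*-identityʳ (+ m))) (sym (ℤ.*-identityʳ (+ n))))

fromℕ-homo-* : ∀ m n → fromℕ (m ℕ.* n) ≡ fromℕ m * fromℕ n
fromℕ-homo-* m n = trans (fromℕ≡/1 (m ℕ.* n)) (cong (_/ 1) (ℤ.pos-* m n))

sum≤ : ∀ c (f : ℕ → ℚ) → (∀ i → f i ≤ c) → ∀ k → foldr _+_ 0ℚ (applyUpTo f k) ≤ fromℕ k * c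
sum≤ c f f≤c zero = ℚ.≤-reflexive (sym (ℚ.*-zeroˡ c))
sum≤ c f f≤c (suc k) = begin
  f 0 + foldr _+_ 0ℚ (applyUpTo (f ∘ suc) k)  ≤⟨ ℚ.+-mono-≤ (f≤c 0) (sum≤ c (f ∘ suc) (f≤c ∘ suc) k) ⟩
  c + fromℕ k * c                             ≡⟨ cong (_+ fromℕ k * c) (ℚ.*-identityˡ c) ⟨
  1ℚ * c + fromℕ k * c                        ≡⟨ ℚ.*-distribʳ-+ c 1ℚ (fromℕ k) ⟨
  (1ℚ + fromℕ k) * c                          ≡⟨ cong (_* c) (fromℕ-homo-+ 1 k) ⟨
  fromℕ (suc k) * c                           ∎
  where open ℚ.≤-Reasoning

logSum≤ : ∀ n m → logSum n m ≤ fromℕ n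
logSum≤ n m = begin
  logSum n m                       ≤⟨ sum≤ c _ term≤c ((n ℕ.∸ 1) ℕ.* m) ⟩
  fromℕ ((n ℕ.∸ 1) ℕ.* m) * c      ≤⟨ ℚ.*-monoʳ-≤-nonNeg c (fromℕ-mono (ℕ.*-mono-≤ (ℕ.m∸n≤m n 1) (ℕ.n≤1+n m))) ⟩
  fromℕ (n ℕ.* suc m) * c          ≡⟨ cong (_* c) (fromℕ-homo-* n (suc m)) ⟩
  fromℕ n * fromℕ (suc m) * c      ≡⟨ ℚ.*-assoc (fromℕ n) (fromℕ (suc m)) c ⟩
  fromℕ n * (fromℕ (suc m) * c)    ≡⟨ cong (fromℕ n *_) (ℚ.*-inverseʳ (fromℕ (suc m))) ⟩
  fromℕ n * 1ℚ                     ≡⟨ ℚ.*-identityʳ (fromℕ n) ⟩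
  fromℕ n                          ∎
  where
  open ℚ.≤-Reasoning
  c = 1/ fromℕ (suc m)
  term≤c : ∀ i → 1/ fromℕ (suc (m ℕ.+ i)) ≤ c
  term≤c i = *≤* (ℤ.*-monoˡ-≤-nonNeg (+ 1) (+≤+ (ℕ.s≤s (ℕ.m≤m+n m i))))

-- log n = ∫₁ⁿ dt/t for n ≥ 1, as the supremum of its lower sums (the empty
-- subdivision m = 0 only contributes 0).
log : ℕ → ℝ≥0
log n = sup (λ r → ∃[ m ] r ≡ logSum n m) (fromℕ n , 0≤fromℕ n , λ { (m , refl) → logSum≤ n m })

{-# OPTIONS --safe #-}
-- A consists of the products x y_k with 1 ≤ x ≤ n² and y_k = 1 + q (n + k),
-- k < n, where n = 2ᵐ and q = 2 (m + 1) is about log n.  A multiplicative Sidon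
-- subset is a bipartite graph without 4-cycles between the n² values of x and
-- the n values of k, so it has at most n² + n² elements.  An additive Sidon
-- subset has O(√N) elements because A lies in [1 , N] with N = O(n³ log n).
-- It remains to see that |A| is of order n³.  For i < k the coincidences
-- x′ y_i = x y_k number at most n² gcd(y_i , y_k) / y_i, where y_i ≥ q n.  A common
-- divisor d of y_i and y_k is coprime to q, hence divides k - i; so for a given k
-- the gcds add up to at most n times the number of divisors d < n of y_k, and
-- on average over k there are at most m + 1 of these.  Altogether at most
-- n² · n (m + 1) / q = n³ / 2 products coincide with earlier ones.
module Submission where

open import Defs
open import Data.Bool.Base using (Bool; true; false; T)
import Data.Integer.Base as ℤ
import Data.Integer.Properties as ℤ
open import Data.List.Base using (List; []; _∷_; _++_; length; map; filter; foldr; upTo; applyUpTo; cartesianProduct)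
open import Data.List.Extrema.Nat using (max≤v⁺)
open import Data.List.Membership.DecPropositional using () renaming (_∈?_ to ∈?)
open import Data.List.Membership.Propositional using (_∈_; _∉_; find; lose)
open import Data.List.Membership.Propositional.Properties
open import Data.List.Properties using (length-map; length-++; length-upTo; length-applyUpTo)
open import Data.List.Relation.Binary.Subset.Propositional using (_⊆_)
open import Data.List.Relation.Unary.All as All using (All; []; _∷_)
import Data.List.Relation.Unary.All.Properties as All
open import Data.List.Relation.Unary.AllPairs using ([]; _∷_)
open import Data.List.Relation.Unary.Any using (here; there; any?)
open import Data.List.Relation.Unary.Unique.Propositional using (Unique)
import Data.List.Relation.Unary.Unique.Propositional.Properties as Unique
open import Data.Nat.Base
open import Data.Nat.Coprimality using (Coprime; coprime-/gcd; coprime-divisor)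
open import Data.Nat.Divisibility
open import Data.Nat.DivMod using (_/_; m/n*n≡m)
open import Data.Nat.GCD using (gcd; gcd[m,n]∣m; gcd[m,n]∣n; gcd[m,n]≢0)
open import Data.Nat.Properties
open import Data.Nat.Tactic.RingSolver using (solve-∀)
open import Data.Product.Base using (∃-syntax; _×_; _,_; proj₁; proj₂)
open import Data.Rational.Base as ℚ using (ℚ; 0ℚ; 1ℚ; 1/_)
import Data.Rational.Properties as ℚ
open import Data.Sum.Base using (_⊎_; inj₁; inj₂)
open import Function.Base using (_∘_)
open import Level using (0ℓ)
open import Relation.Binary.PropositionalEquality
open import Relation.Nullary using (¬_; Dec; yes; no; contradiction)
open import Relation.Nullary.Decidable using (¬?)
open import Relation.Unary using (Pred; Decidable)

-- Sidon sets

private variable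
  X Y : Set

length-cartesianProduct : ∀ (xs : List X) (ys : List Y) →
                          length (cartesianProduct xs ys) ≡ length xs * length ys
length-cartesianProduct [] ys = refl
length-cartesianProduct (x ∷ xs) ys = trans (length-++ (map (x ,_) ys))
  (cong₂ _+_ (length-map (x ,_) ys) (length-cartesianProduct xs ys))

∷-⊆-++∷⇒⊆-++ : ∀ {x : X} {xs} as {bs} → x ∉ xs → x ∷ xs ⊆ as ++ x ∷ bs → xs ⊆ as ++ bs
∷-⊆-++∷⇒⊆-++ as x∉xs sub z∈xs with ∈-++⁻ as (sub (there z∈xs))
... | inj₁ z∈as         = ∈-++⁺ˡ z∈as
... | inj₂ (here refl)  = contradiction z∈xs x∉xs
... | inj₂ (there z∈bs) = ∈-++⁺ʳ as z∈bs

-- Induction on `xs`: one occurrence of its head is deleted from `ys`, and uniqueness keeps the tail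
-- inside what remains.
Unique-⊆⇒length≤ : ∀ {xs ys : List X} → Unique xs → xs ⊆ ys → length xs ≤ length ys
Unique-⊆⇒length≤ {xs = []} _ _ = z≤n
Unique-⊆⇒length≤ {xs = x ∷ xs} u@(_ ∷ uxs) xs⊆ys
  with as , bs , refl ← ∈-∃++ (xs⊆ys (here refl)) = begin
  suc (length xs)              ≤⟨ s≤s (Unique-⊆⇒length≤ uxs (∷-⊆-++∷⇒⊆-++ as (Unique.Unique[x∷xs]⇒x∉xs u) xs⊆ys)) ⟩
  suc (length (as ++ bs))      ≡⟨ cong suc (length-++ as) ⟩
  suc (length as + length bs)  ≡⟨ +-suc (length as) (length bs) ⟨
  length as + suc (length bs)  ≡⟨ length-++ as ⟨
  length (as ++ x ∷ bs)        ∎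
  where open ≤-Reasoning

-- Injectivity is asked only on the members of `xs`: the map `code` below is injective only on pairs
-- taken from a Sidon set.
Unique-map-∈ : ∀ (f : X → Y) {xs} → (∀ {x y} → x ∈ xs → y ∈ xs → f x ≡ f y → x ≡ y) →
               Unique xs → Unique (map f xs)
Unique-map-∈ f inj [] = []
Unique-map-∈ f inj (x∉xs ∷ u) =
  All.map⁺ (All.tabulate λ y∈xs fx≡fy → All.lookup x∉xs y∈xs (inj (here refl) (there y∈xs) fx≡fy))
  ∷ Unique-map-∈ f (λ x∈ y∈ → inj (there x∈) (there y∈)) u

subsets-⊆ : ∀ A {S} → S ∈ subsets A → S ⊆ A
subsets-⊆ [] (here refl) ()
subsets-⊆ (x ∷ A) S∈ z∈S with ∈-++⁻ (subsets A) S∈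
... | inj₁ S∈A = there (subsets-⊆ A S∈A z∈S)
... | inj₂ S∈map with T , T∈A , refl ← ∈-map⁻ (x ∷_) S∈map with z∈S
...   | here refl = here refl
...   | there z∈T = there (subsets-⊆ A T∈A z∈T)

subsets-Unique : ∀ {A S} → Unique A → S ∈ subsets A → Unique S
subsets-Unique [] (here refl) = []
subsets-Unique {x ∷ A} u@(_ ∷ uA) S∈ with ∈-++⁻ (subsets A) S∈
... | inj₁ S∈A = subsets-Unique uA S∈A
... | inj₂ S∈map with T , T∈A , refl ← ∈-map⁻ (x ∷_) S∈map =
  All.tabulate (λ { z∈T refl → Unique.Unique[x∷xs]⇒x∉xs u (subsets-⊆ A T∈A z∈T) }) ∷ subsets-Unique uA T∈A

maxSidon≤ : ∀ _∙_ {A b} → Unique A →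
            (∀ {S} → Unique S → S ⊆ A → IsSidon _∙_ S → length S ≤ b) → maxSidon _∙_ A ≤ b
-- `z≤n` accounts for the default value 0 of the maximum.
maxSidon≤ _∙_ {A} uA bound = max≤v⁺ z≤n (All.map⁺ (All.tabulate λ S∈ →
  let S∈A , S-sidon = ∈-filter⁻ (isSidon? _∙_) {xs = subsets A} S∈
  in bound (subsets-Unique uA S∈A) (subsets-⊆ A S∈A) S-sidon))

≤ᵇ-swap⇒≡ : ∀ {a b} → (a ≤ᵇ b) ≡ (b ≤ᵇ a) → a ≡ b
≤ᵇ-swap⇒≡ {a} {b} eq with ≤-total a b
... | inj₁ a≤b = ≤-antisym a≤b (≤ᵇ⇒≤ b a (subst T eq (≤⇒≤ᵇ a≤b)))
... | inj₂ b≤a = ≤-antisym (≤ᵇ⇒≤ a b (subst T (sym eq) (≤⇒≤ᵇ b≤a))) b≤a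

-- The sum a + b determines the ordered pair (a , b) up to swapping, and the
-- truth value of a ≤ b settles the order.
additive-Sidon-bound : ∀ {S N} → Unique S → All (λ s → NonZero s × s ≤ N) S → IsSidon _+_ S →
                       length S * length S ≤ 4 * N
additive-Sidon-bound {S} {N} uS S≤N sidon = begin
  length S * length S                       ≡⟨ length-cartesianProduct S S ⟨
  length (cartesianProduct S S)             ≡⟨ length-map code (cartesianProduct S S) ⟨
  length (map code (cartesianProduct S S))  ≤⟨ Unique-⊆⇒length≤ (Unique-map-∈ code code-inj (Unique.cartesianProduct⁺ uS uS)) codes⊆ ⟩
  length (cartesianProduct sums bools)      ≡⟨ length-cartesianProduct sums bools ⟩
  length sums * 2                           ≡⟨ cong (_* 2) (length-applyUpTo suc (N + N)) ⟩
  (N + N) * 2                               ≡⟨ lem N ⟩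
  4 * N                                     ∎
  where
  open ≤-Reasoning
  lem : ∀ N → (N + N) * 2 ≡ 4 * N
  lem = solve-∀
  -- The numbers from 1 to 2 N: the entries of `S` are positive, so the sum 0 is left out and there
  -- are exactly 4 N codes.
  sums = applyUpTo suc (N + N)
  bools = false ∷ true ∷ []
  code : ℕ × ℕ → ℕ × Bool
  code (a , b) = a + b , (a ≤ᵇ b)
  code-inj : ∀ {p p′} → p ∈ cartesianProduct S S → p′ ∈ cartesianProduct S S → code p ≡ code p′ → p ≡ p′
  code-inj {a , b} {c , d} p∈ p′∈ eq
    with a∈ , b∈ ← ∈-cartesianProduct⁻ S S p∈ | c∈ , d∈ ← ∈-cartesianProduct⁻ S S p′∈
    with sidon a∈ b∈ c∈ d∈ (cong proj₁ eq)
  ... | inj₁ (refl , refl) = refl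
  ... | inj₂ (refl , refl) with refl ← ≤ᵇ-swap⇒≡ {a} {b} (cong proj₂ eq) = refl
  codes⊆ : map code (cartesianProduct S S) ⊆ cartesianProduct sums bools
  codes⊆ z∈ with (a , b) , p∈ , refl ← ∈-map⁻ code z∈
    with a∈ , b∈ ← ∈-cartesianProduct⁻ S S p∈ =
    ∈-cartesianProduct⁺ (sum∈ (All.lookup S≤N a∈) (All.lookup S≤N b∈)) (bool∈ _)
    where
    sum∈ : ∀ {a b} → NonZero a × a ≤ N → NonZero b × b ≤ N → a + b ∈ sums
    sum∈ {suc a} (_ , a≤N) (_ , b≤N) = ∈-applyUpTo⁺ suc (+-mono-≤ a≤N b≤N)
    bool∈ : ∀ c → c ∈ bools
    bool∈ false = here refl
    bool∈ true  = there (here refl)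

-- R lists the pairs (x , k) representing the elements x y_k of a multiplicative
-- Sidon set.  The mark of (x , k) is (k , k′) for a later pair (x , k′) with the
-- same x if there is one, and x otherwise.  Marks do not repeat, since
-- (x y_k)(x′ y_k′) = (x y_k′)(x′ y_k).
marks : List (ℕ × ℕ) → List (ℕ ⊎ ℕ × ℕ)
marks [] = []
marks ((x , k) ∷ R) with any? (λ p → x ≟ proj₁ p) R
... | yes p = inj₂ (k , proj₂ (proj₁ (find p))) ∷ marks R
... | no  _ = inj₁ x ∷ marks R

length-marks : ∀ R → length (marks R) ≡ length R
length-marks [] = refl
length-marks ((x , k) ∷ R) with any? (λ p → x ≟ proj₁ p) R
... | yes _ = cong suc (length-marks R)
... | no  _ = cong suc (length-marks R)

inj₁∈marks⇒ : ∀ R {x} → inj₁ x ∈ marks R → ∃[ k ] (x , k) ∈ R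
inj₁∈marks⇒ ((x , k) ∷ R) z∈ with any? (λ p → x ≟ proj₁ p) R
inj₁∈marks⇒ ((x , k) ∷ R) (here refl) | no _ = k , here refl
inj₁∈marks⇒ ((x , k) ∷ R) (there z∈)  | no _ = let k′ , p∈ = inj₁∈marks⇒ R z∈ in k′ , there p∈
inj₁∈marks⇒ ((x , k) ∷ R) (there z∈)  | yes _ = let k′ , p∈ = inj₁∈marks⇒ R z∈ in k′ , there p∈

inj₂∈marks⇒ : ∀ R {k k′} → inj₂ (k , k′) ∈ marks R → ∃[ x ] (x , k) ∈ R × (x , k′) ∈ R
inj₂∈marks⇒ ((x , k) ∷ R) z∈ with any? (λ p → x ≟ proj₁ p) R
inj₂∈marks⇒ ((x , k) ∷ R) (here refl) | yes p with (x , _) , p∈ , refl ← find p = x , here refl , there p∈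
inj₂∈marks⇒ ((x , k) ∷ R) (there z∈)  | yes _ = let x′ , p∈ , p′∈ = inj₂∈marks⇒ R z∈ in x′ , there p∈ , there p′∈
inj₂∈marks⇒ ((x , k) ∷ R) (there z∈)  | no _ = let x′ , p∈ , p′∈ = inj₂∈marks⇒ R z∈ in x′ , there p∈ , there p′∈

module _ (y : ℕ → ℕ) (y-nonZero : ∀ k → NonZero (y k)) (y-injective : ∀ {i k} → y i ≡ y k → i ≡ k) where

  -- The shift lets the indices x < M stand for the multipliers 1, ..., M.
  value : ℕ × ℕ → ℕ
  value (x , k) = suc x * y k

  marks-Unique : ∀ {R} → Unique R → IsSidon _*_ (map value R) → Unique (marks R)
  marks-Unique [] _ = []
  marks-Unique {(x , k) ∷ R} u@(_ ∷ uR) sidon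
    with any? (λ p → x ≟ proj₁ p) R
       | marks-Unique uR (λ a∈ b∈ c∈ d∈ → sidon (there a∈) (there b∈) (there c∈) (there d∈))
  ... | no  x∉ | uM = All.tabulate
          (λ { z∈ refl → let k′ , p∈ = inj₁∈marks⇒ R z∈ in x∉ (lose p∈ refl) }) ∷ uM
  ... | yes p | uM with (x , k′) , p∈ , refl ← find p = All.tabulate
          (λ { z∈ refl → let x′ , q∈ , q′∈ = inj₂∈marks⇒ R z∈ in absurd q∈ q′∈ }) ∷ uM
    where
    val∈ : ∀ {p} → p ∈ (x , k) ∷ R → value p ∈ map value ((x , k) ∷ R)
    val∈ = ∈-map⁺ value
    xk∉R = Unique.Unique[x∷xs]⇒x∉xs u
    absurd : ∀ {x′} → (x′ , k) ∈ R → ¬ (x′ , k′) ∈ R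
    -- Both trivial solutions put the head `(x , k)` into `R`: the first forces `k ≡ k′`, the second
    -- `x ≡ x′`.
    absurd {x′} q∈ q′∈ with sidon (val∈ (here refl)) (val∈ (there q′∈)) (val∈ (there p∈)) (val∈ (there q∈))
                               (lem (suc x) (y k) (suc x′) (y k′))
      where
      lem : ∀ a b c d → a * b * (c * d) ≡ a * d * (c * b)
      lem = solve-∀
    ... | inj₁ (eq , _) with refl ← y-injective (*-cancelˡ-≡ (y k) (y k′) (suc x) eq) = xk∉R p∈
    ... | inj₂ (eq , _) with refl ← *-cancelʳ-≡ (suc x) (suc x′) (y k) {{y-nonZero k}} eq = xk∉R q∈

  -- One representation is chosen per element. Since `S` becomes literally `map value R`, its
  -- uniqueness passes to `R`.
  representatives : ∀ {M n S} → All (λ s → ∃[ x ] ∃[ k ] x < M × k < n × s ≡ suc x * y k) S →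
                    ∃[ R ] All (λ p → proj₁ p < M × proj₂ p < n) R × S ≡ map value R
  representatives [] = [] , [] , refl
  representatives ((x , k , x<M , k<n , refl) ∷ reps) with R , R< , refl ← representatives reps =
    (x , k) ∷ R , (x<M , k<n) ∷ R< , refl

  -- The marks are distinct and as many as the elements of `S`; only M marks `inj₁ x` and n² marks
  -- `inj₂ (k , k′)` are possible.
  multiplicative-Sidon-bound : ∀ {M n S} → Unique S →
    All (λ s → ∃[ x ] ∃[ k ] x < M × k < n × s ≡ suc x * y k) S → IsSidon _*_ S →
    length S ≤ M + n * n
  multiplicative-Sidon-bound {M} {n} uS reps sidon with R , R< , refl ← representatives reps = begin
    length (map value R)                       ≡⟨ length-map value R ⟩
    length R                                   ≡⟨ length-marks R ⟨
    length (marks R)                           ≤⟨ Unique-⊆⇒length≤ (marks-Unique (Unique.map⁻ uS) sidon) marks⊆ ⟩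
    length (map inj₁ (upTo M) ++ map inj₂ K²)  ≡⟨ length-++ (map inj₁ (upTo M)) ⟩
    length (map inj₁ (upTo M)) + length (map inj₂ K²)
      ≡⟨ cong₂ _+_ (trans (length-map inj₁ (upTo M)) (length-upTo M))
                   (trans (length-map inj₂ K²) (trans (length-cartesianProduct (upTo n) (upTo n)) (cong₂ _*_ (length-upTo n) (length-upTo n)))) ⟩
    M + n * n                                   ∎
    where
    open ≤-Reasoning
    K² = cartesianProduct (upTo n) (upTo n)
    marks⊆ : marks R ⊆ map inj₁ (upTo M) ++ map inj₂ K²
    marks⊆ {inj₁ x} z∈ =
      let k , p∈ = inj₁∈marks⇒ R z∈
      in ∈-++⁺ˡ (∈-map⁺ inj₁ (∈-upTo⁺ (proj₁ (All.lookup R< p∈))))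
    marks⊆ {inj₂ (k , k′)} z∈ =
      let x , p∈ , p′∈ = inj₂∈marks⇒ R z∈
      in ∈-++⁺ʳ (map inj₁ (upTo M)) (∈-map⁺ inj₂ (∈-cartesianProduct⁺
           (∈-upTo⁺ (proj₂ (All.lookup R< p∈))) (∈-upTo⁺ (proj₂ (All.lookup R< p′∈)))))

-- A multiplication table with few collisions

∑ : (ℕ → ℕ) → ℕ → ℕ
∑ f zero    = 0
∑ f (suc n) = ∑ f n + f n

∑-mono : ∀ {f g} n → (∀ i → i < n → f i ≤ g i) → ∑ f n ≤ ∑ g n
∑-mono zero    f≤g = z≤n
∑-mono (suc n) f≤g = +-mono-≤ (∑-mono n λ i i<n → f≤g i (m<n⇒m<1+n i<n)) (f≤g n ≤-refl)

∑-+ : ∀ f g n → ∑ (λ i → f i + g i) n ≡ ∑ f n + ∑ g n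
∑-+ f g zero    = refl
∑-+ f g (suc n) = trans (cong (_+ (f n + g n)) (∑-+ f g n)) (lem (∑ f n) (∑ g n) (f n) (g n))
  where
  lem : ∀ a b c d → a + b + (c + d) ≡ a + c + (b + d)
  lem = solve-∀

∑-*ˡ : ∀ c f n → ∑ (λ i → c * f i) n ≡ c * ∑ f n
∑-*ˡ c f zero    = sym (*-zeroʳ c)
∑-*ˡ c f (suc n) = trans (cong (_+ c * f n) (∑-*ˡ c f n)) (sym (*-distribˡ-+ c (∑ f n) (f n)))

∑-const : ∀ c n → ∑ (λ _ → c) n ≡ n * c
∑-const c zero    = refl
∑-const c (suc n) = trans (+-comm (∑ (λ _ → c) n) c) (cong (c +_) (∑-const c n))

∑-swap : ∀ (f : ℕ → ℕ → ℕ) m n → ∑ (λ i → ∑ (f i) m) n ≡ ∑ (λ j → ∑ (λ i → f i j) n) m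
∑-swap f m zero    = sym (trans (∑-const 0 m) (*-zeroʳ m))
∑-swap f m (suc n) = trans (cong (_+ ∑ (f n) m) (∑-swap f m n)) (sym (∑-+ (λ j → ∑ (λ i → f i j) n) (f n) m))

∑-split : ∀ f m n → ∑ f (m + n) ≡ ∑ f m + ∑ (λ i → f (m + i)) n
∑-split f m zero    = trans (cong (∑ f) (+-identityʳ m)) (sym (+-identityʳ (∑ f m)))
∑-split f m (suc n) rewrite +-suc m n | ∑-split f m n = +-assoc (∑ f m) _ (f (m + n))

∑-term : ∀ {f i n} → i < n → f i ≤ ∑ f n
∑-term {f} {i} {suc n} (s≤s i≤n) with m≤n⇒m<n∨m≡n i≤n
... | inj₁ i<n  = ≤-trans (∑-term i<n) (m≤m+n _ _)
... | inj₂ refl = m≤n+m _ _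

-- Counting solutions that lie apart

𝟙 : ∀ {P : Set} → Dec P → ℕ
𝟙 (yes _) = 1
𝟙 (no _)  = 0

𝟙-yes : ∀ {P : Set} (P? : Dec P) → P → 𝟙 P? ≡ 1
𝟙-yes (yes _) p = refl
𝟙-yes (no ¬p) p = contradiction p ¬p

count : ∀ {P : Pred ℕ 0ℓ} → Decidable P → ℕ → ℕ
count P? = ∑ (λ i → 𝟙 (P? i))

-- The intervals [i , i + d) attached to the solutions i < n are disjoint and contained in [0 , m).
count-gap : ∀ {P : Pred ℕ 0ℓ} (P? : Decidable P) {d} → (∀ {i j} → i < j → P i → P j → i + d ≤ j) →
            ∀ n {m} → (∀ {i} → i < n → P i → i + d ≤ m) → count P? n * d ≤ m
count-gap P? gap zero    end = z≤n
count-gap P? {d} gap (suc n) {m} end with P? n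
... | no  _  = subst (λ c → c * d ≤ m) (sym (+-identityʳ (count P? n)))
                 (count-gap P? gap n λ i<n → end (m<n⇒m<1+n i<n))
... | yes Pn = begin
  (count P? n + 1) * d    ≡⟨ *-distribʳ-+ d (count P? n) 1 ⟩
  count P? n * d + 1 * d  ≤⟨ +-mono-≤ (count-gap P? gap n λ i<n Pi → gap i<n Pi Pn) (≤-reflexive (*-identityˡ d)) ⟩
  n + d                   ≤⟨ end ≤-refl Pn ⟩
  m                       ∎
  where open ≤-Reasoning

-- If `a` divides i b and j b, then e = a / gcd a b divides j - i, because e is coprime to b / gcd a
-- b. So the solutions lie at least e apart.
count-divisible : ∀ a b .{{_ : NonZero a}} M → a * count (λ x → a ∣? suc x * b) M ≤ M * gcd a b
count-divisible a b M = begin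
  a * c      ≡⟨ cong (_* c) a≡eg ⟩
  e * g * c  ≡⟨ lem e g c ⟩
  c * e * g  ≤⟨ *-monoˡ-≤ g (+-cancelʳ-≤ e (c * e) M ce+e≤M+e) ⟩
  M * g      ∎
  where
  open ≤-Reasoning
  lem : ∀ e g c → e * g * c ≡ c * e * g
  lem = solve-∀
  g = gcd a b
  instance
    g≢0 : NonZero g
    g≢0 = ≢-nonZero (gcd[m,n]≢0 a b (inj₁ (≢-nonZero⁻¹ a)))
  e = a / g
  f = b / g
  a≡eg : a ≡ e * g
  a≡eg = sym (m/n*n≡m (gcd[m,n]∣m a b))
  b≡fg : b ≡ f * g
  b≡fg = sym (m/n*n≡m (gcd[m,n]∣n a b))
  multiple? : Decidable (λ x → a ∣ x * b)
  multiple? x = a ∣? x * b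
  c = count (λ x → a ∣? suc x * b) M
  gap : ∀ {i j} → i < j → a ∣ i * b → a ∣ j * b → i + e ≤ j
  gap {i} i<j ai aj with t , refl ← m≤n⇒∃[o]m+o≡n i<j =
    subst (i + e ≤_) (+-suc i t) (+-monoʳ-≤ i (∣⇒≤ (coprime-divisor (coprime-/gcd a b)
      (*-cancelʳ-∣ g (subst₂ _∣_ a≡eg (lem′ (suc t) b≡fg) a∣tb)))))
    where
    lem′ : ∀ t → b ≡ f * g → t * b ≡ f * t * g
    lem′ t eq = trans (cong (t *_) eq) (lem″ t f g)
      where
      lem″ : ∀ t f g → t * (f * g) ≡ f * t * g
      lem″ = solve-∀
    a∣tb : a ∣ suc t * b
    a∣tb = ∣m+n∣m⇒∣n (subst (a ∣_) (trans (cong (_* b) (sym (+-suc i t))) (*-distribʳ-+ b i (suc t))) aj) ai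
  -- The solution 0, added to the c solutions in [1 , M], makes up for the last interval, which may
  -- reach as far as M + e.
  ce+e≤M+e : c * e + e ≤ M + e
  ce+e≤M+e = begin
    c * e + e                    ≡⟨ +-comm (c * e) e ⟩
    suc c * e                    ≡⟨ cong (λ o → (o + c) * e) (𝟙-yes (multiple? 0) (a ∣0)) ⟨
    (𝟙 (multiple? 0) + c) * e    ≡⟨ cong (_* e) (∑-split (λ x → 𝟙 (multiple? x)) 1 M) ⟨
    count multiple? (suc M) * e  ≤⟨ count-gap multiple? gap (suc M) (λ { (s≤s i≤M) _ → +-monoˡ-≤ e i≤M }) ⟩
    M + e                        ∎

-- The terms with index in [2ᵃ , 2ᵃ⁺¹) add up to at most n + 2ᵃ.
harmonic-bound : ∀ {f n} → f 0 ≡ 0 → (∀ d → f d * d ≤ n + d) → ∀ a → ∑ f (2 ^ a) ≤ a * n + 2 ^ a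
-- The only index is 0, about which the inequality for `f d * d` says nothing.
harmonic-bound f0≡0 _ zero = ≤-trans (≤-reflexive f0≡0) z≤n
harmonic-bound {f} {n} f0≡0 fd≤ (suc a) = begin
  ∑ f (2 * p)                    ≡⟨ cong (λ z → ∑ f (p + z)) (+-identityʳ p) ⟩
  ∑ f (p + p)                    ≡⟨ ∑-split f p p ⟩
  ∑ f p + ∑ (λ i → f (p + i)) p  ≤⟨ +-mono-≤ (harmonic-bound f0≡0 fd≤ a) block ⟩
  a * n + p + (n + p)            ≡⟨ lem a n p ⟩
  suc a * n + 2 * p              ∎
  where
  open ≤-Reasoning
  lem : ∀ a n p → a * n + p + (n + p) ≡ (n + a * n) + (p + (p + 0))
  lem = solve-∀
  p = 2 ^ a
  instance
    p≢0 : NonZero p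
    p≢0 = m^n≢0 2 a
  -- For a positive count, one copy of p + j is cancelled on both sides before p + j is lowered to
  -- p.
  term : ∀ j c → c * (p + j) ≤ n + (p + j) → p * c ≤ n + p
  term j zero    _ = subst (_≤ n + p) (sym (*-zeroʳ p)) z≤n
  term j (suc c) h = begin
    p * suc c        ≡⟨ *-suc p c ⟩
    p + p * c        ≡⟨ +-comm p (p * c) ⟩
    p * c + p        ≡⟨ cong (_+ p) (*-comm p c) ⟩
    c * p + p        ≤⟨ +-monoˡ-≤ p (*-monoʳ-≤ c (m≤m+n p j)) ⟩
    c * (p + j) + p  ≤⟨ +-monoˡ-≤ p (+-cancelˡ-≤ (p + j) (c * (p + j)) n (subst (p + j + c * (p + j) ≤_) (+-comm n (p + j)) h)) ⟩
    n + p            ∎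
  block : ∑ (λ i → f (p + i)) p ≤ n + p
  block = *-cancelˡ-≤ p (begin
    p * ∑ (λ i → f (p + i)) p  ≡⟨ ∑-*ˡ p (λ i → f (p + i)) p ⟨
    ∑ (λ i → p * f (p + i)) p  ≤⟨ ∑-mono p (λ j _ → term j (f (p + j)) (fd≤ (p + j))) ⟩
    ∑ (λ _ → n + p) p          ≡⟨ ∑-const (n + p) p ⟩
    p * (n + p)                ∎)

-- Common divisors in an arithmetic progression

module Progression (q n : ℕ) .{{_ : NonZero q}} where

  y : ℕ → ℕ
  y k = suc (q * (n + k))

  y-+ : ∀ i t → y (i + t) ≡ y i + q * t
  y-+ i t = lem q n i t
    where
    lem : ∀ q n i t → 1 + q * (n + (i + t)) ≡ 1 + q * (n + i) + q * t
    lem = solve-∀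

  y-injective : ∀ {i k} → y i ≡ y k → i ≡ k
  y-injective {i} {k} eq = +-cancelˡ-≡ n i k (*-cancelˡ-≡ (n + i) (n + k) q (suc-injective eq))

  qn≤y : ∀ k → q * n ≤ y k
  qn≤y k = m≤n⇒m≤1+n (*-monoʳ-≤ q (m≤m+n n k))

  y≤2qn : ∀ {k} → k < n → y k ≤ q * (2 * n)
  y≤2qn {k} k<n = begin
    1 + q * (n + k)    ≤⟨ +-monoˡ-≤ (q * (n + k)) (>-nonZero⁻¹ q) ⟩
    q + q * (n + k)    ≡⟨ *-suc q (n + k) ⟨
    q * (1 + (n + k))  ≡⟨ cong (q *_) (+-suc n k) ⟨
    q * (n + suc k)    ≤⟨ *-monoʳ-≤ q (+-monoʳ-≤ n k<n) ⟩
    q * (n + n)        ≡⟨ cong (λ z → q * (n + z)) (+-identityʳ n) ⟨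
    q * (2 * n)        ∎
    where open ≤-Reasoning

  -- Divisors of y i = 1 + q (n + i) are coprime to q.
  y-gap : ∀ {d i j} → i < j → d ∣ y i → d ∣ y j → i + d ≤ j
  y-gap {d} {i} i<j d∣yi d∣yj with t , refl ← m≤n⇒∃[o]m+o≡n i<j =
    subst (i + d ≤_) (+-suc i t) (+-monoʳ-≤ i (∣⇒≤ (coprime-divisor d⊥q d∣qt)))
    where
    d∣qt : d ∣ q * suc t
    d∣qt = ∣m+n∣m⇒∣n (subst (d ∣_) (trans (cong y (sym (+-suc i t))) (y-+ i (suc t))) d∣yj) d∣yi
    d⊥q : Coprime d q
    d⊥q {e} (e∣d , e∣q) = ∣1⇒≡1 (∣m+n∣m⇒∣n (subst (e ∣_) (+-comm 1 (q * (n + i))) (∣-trans e∣d d∣yi)) (∣m⇒∣m*n (n + i) e∣q))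

  -- Divisors below `n` suffice: by `y-gap`, a common divisor of two terms with distinct indices is
  -- at most the difference of the indices.
  divisors : ℕ → ℕ
  divisors k = ∑ (λ d → 𝟙 (d ∣? y k)) n

  -- The right side adds up all common divisors below `n`, and the gcd is one of them. In this form
  -- the sums over i and d can be exchanged.
  gcd-bound : ∀ {i k} → i < k → k < n →
              gcd (y i) (y k) ≤ ∑ (λ d → 𝟙 (d ∣? y k) * (d * 𝟙 (d ∣? y i))) n
  gcd-bound {i} {k} i<k k<n = begin
    g                                              ≡⟨ lem g ⟨
    1 * (g * 1)                                    ≡⟨ cong₂ (λ a b → a * (g * b)) (𝟙-yes (g ∣? y k) g∣yk) (𝟙-yes (g ∣? y i) g∣yi) ⟨
    𝟙 (g ∣? y k) * (g * 𝟙 (g ∣? y i))              ≤⟨ ∑-term g<n ⟩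
    ∑ (λ d → 𝟙 (d ∣? y k) * (d * 𝟙 (d ∣? y i))) n  ∎
    where
    open ≤-Reasoning
    lem : ∀ g → 1 * (g * 1) ≡ g
    lem = solve-∀
    g = gcd (y i) (y k)
    g∣yi = gcd[m,n]∣m (y i) (y k)
    g∣yk = gcd[m,n]∣n (y i) (y k)
    g<n : g < n
    g<n = ≤-<-trans (m+n≤o⇒n≤o i (y-gap i<k g∣yi g∣yk)) k<n

  -- For a fixed divisor d of `y k`, the indices i < k with d dividing `y i` lie at least d apart
  -- and at least d before k. Hence d contributes at most k ≤ n.
  gcd-sum-bound : ∀ {k} → k < n → ∑ (λ i → gcd (y i) (y k)) k ≤ divisors k * n
  gcd-sum-bound {k} k<n = begin
    ∑ (λ i → gcd (y i) (y k)) k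
      ≤⟨ ∑-mono k (λ i i<k → gcd-bound i<k k<n) ⟩
    ∑ (λ i → ∑ (λ d → 𝟙 (d ∣? y k) * (d * 𝟙 (d ∣? y i))) n) k
      ≡⟨ ∑-swap (λ i d → 𝟙 (d ∣? y k) * (d * 𝟙 (d ∣? y i))) n k ⟩
    ∑ (λ d → ∑ (λ i → 𝟙 (d ∣? y k) * (d * 𝟙 (d ∣? y i))) k) n
      ≤⟨ ∑-mono n (λ d _ → per-divisor d) ⟩
    ∑ (λ d → n * 𝟙 (d ∣? y k)) n
      ≡⟨ ∑-*ˡ n (λ d → 𝟙 (d ∣? y k)) n ⟩
    n * divisors k
      ≡⟨ *-comm n (divisors k) ⟩
    divisors k * n ∎
    where
    open ≤-Reasoning
    per-divisor : ∀ d → ∑ (λ i → 𝟙 (d ∣? y k) * (d * 𝟙 (d ∣? y i))) k ≤ n * 𝟙 (d ∣? y k)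
    per-divisor d with d ∣? y k
    ... | no  _ = ≤-trans (≤-reflexive (trans (∑-const 0 k) (*-zeroʳ k))) z≤n
    ... | yes d∣yk = begin
      ∑ (λ i → 1 * (d * 𝟙 (d ∣? y i))) k  ≡⟨ ∑-*ˡ 1 (λ i → d * 𝟙 (d ∣? y i)) k ⟩
      1 * ∑ (λ i → d * 𝟙 (d ∣? y i)) k    ≡⟨ *-identityˡ _ ⟩
      ∑ (λ i → d * 𝟙 (d ∣? y i)) k        ≡⟨ ∑-*ˡ d (λ i → 𝟙 (d ∣? y i)) k ⟩
      d * count (λ i → d ∣? y i) k        ≡⟨ *-comm d _ ⟩
      count (λ i → d ∣? y i) k * d        ≤⟨ count-gap (λ i → d ∣? y i) y-gap k (λ i<k d∣yi → y-gap i<k d∣yi d∣yk) ⟩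
      k                                   ≤⟨ <⇒≤ k<n ⟩
      n                                   ≡⟨ *-identityʳ n ⟨
      n * 1                               ∎

  module _ (M : ℕ) where

    -- Only an upper count of the repeated products: the quotient may exceed M, and several i may
    -- serve the same x.
    collisions : ℕ → ℕ
    collisions k = ∑ (λ i → count (λ x → y i ∣? suc x * y k) M) k

    -- Each `y i` is at least q n, while `y i` times its count is at most M times the gcd. The
    -- factor n from `gcd-sum-bound` then cancels.
    collisions-bound : ∀ {k} → k < n → q * collisions k ≤ M * divisors k
    collisions-bound {k} k<n = *-cancelˡ-≤ n {{>-nonZero (≤-<-trans z≤n k<n)}} (begin
      n * (q * collisions k)           ≡⟨ lem n q (collisions k) ⟩
      q * n * collisions k             ≡⟨ ∑-*ˡ (q * n) c k ⟨
      ∑ (λ i → q * n * c i) k          ≤⟨ ∑-mono k (λ i _ → *-monoˡ-≤ (c i) (qn≤y i)) ⟩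
      ∑ (λ i → y i * c i) k            ≤⟨ ∑-mono k (λ i _ → count-divisible (y i) (y k) M) ⟩
      ∑ (λ i → M * gcd (y i) (y k)) k  ≡⟨ ∑-*ˡ M (λ i → gcd (y i) (y k)) k ⟩
      M * ∑ (λ i → gcd (y i) (y k)) k  ≤⟨ *-monoʳ-≤ M (gcd-sum-bound k<n) ⟩
      M * (divisors k * n)             ≡⟨ lem′ M (divisors k) n ⟩
      n * (M * divisors k)             ∎)
      where
      open ≤-Reasoning
      c : ℕ → ℕ
      c i = count (λ x → y i ∣? suc x * y k) M
      lem : ∀ n q c → n * (q * c) ≡ q * n * c
      lem = solve-∀
      lem′ : ∀ M d n → M * (d * n) ≡ n * (M * d)
      lem′ = solve-∀

    -- Exchanging the sums counts, for each d < n, the terms divisible by d. These are at most n / d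
    -- + 1 for d > 0 and none for d = 0, so a harmonic sum bounds the total.
    total-collisions-bound : ∀ m → n ≡ 2 ^ m → q * ∑ collisions n ≤ M * (suc m * n)
    total-collisions-bound m n≡2^m = begin
      q * ∑ collisions n            ≡⟨ ∑-*ˡ q collisions n ⟨
      ∑ (λ k → q * collisions k) n  ≤⟨ ∑-mono n (λ k → collisions-bound) ⟩
      ∑ (λ k → M * divisors k) n    ≡⟨ ∑-*ˡ M divisors n ⟩
      M * ∑ divisors n              ≡⟨ cong (M *_) (∑-swap (λ k d → 𝟙 (d ∣? y k)) n n) ⟩
      M * ∑ multiples n             ≤⟨ *-monoʳ-≤ M (subst (λ z → ∑ multiples z ≤ m * n + z) (sym n≡2^m) (harmonic-bound multiples0 multiples-bound m)) ⟩
      M * (m * n + n)               ≡⟨ cong (M *_) (+-comm (m * n) n) ⟩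
      M * (suc m * n)               ∎
      where
      open ≤-Reasoning
      multiples : ℕ → ℕ
      multiples d = count (λ k → d ∣? y k) n
      multiples0 : multiples 0 ≡ 0
      multiples0 = n≤0⇒n≡0 (≤-trans (∑-mono {g = λ _ → 0} n λ k _ → none k) (≤-reflexive (trans (∑-const 0 n) (*-zeroʳ n))))
        where
        none : ∀ k → 𝟙 (0 ∣? y k) ≤ 0
        none k with 0 ∣? y k
        ... | no _ = z≤n
        ... | yes 0∣y = contradiction (0∣⇒≡0 0∣y) λ ()
      multiples-bound : ∀ d → multiples d * d ≤ n + d
      multiples-bound d = count-gap (λ k → d ∣? y k) y-gap n (λ i<n _ → +-monoˡ-≤ d (<⇒≤ i<n))

    -- The set of products and its size

    layer : ℕ → List ℕ
    layer k = applyUpTo (λ x → suc x * y k) M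

    products : ℕ → List ℕ
    products zero    = []
    products (suc k) = filter (λ a → ¬? (∈? _≟_ a (products k))) (layer k) ++ products k

    products-Unique : ∀ k → Unique (products k)
    products-Unique zero    = []
    products-Unique (suc k) = Unique.++⁺
      (Unique.filter⁺ _ (Unique.applyUpTo⁺₁ _ M λ {i} {j} i<j _ eq →
        <⇒≢ i<j (suc-injective (*-cancelʳ-≡ (suc i) (suc j) (y k) eq))))
      (products-Unique k)
      (λ (a∈ , a∈k) → proj₂ (∈-filter⁻ (λ a → ¬? (∈? _≟_ a (products k))) {xs = layer k} a∈) a∈k)

    products-representation : ∀ k {a} → a ∈ products k → ∃[ x ] ∃[ i ] x < M × i < k × a ≡ suc x * y i
    products-representation (suc k) a∈ with ∈-++⁻ (filter (λ a → ¬? (∈? _≟_ a (products k))) (layer k)) a∈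
    ... | inj₁ a∈new
      with x , x<M , eq ← ∈-applyUpTo⁻ (λ x → suc x * y k) (proj₁ (∈-filter⁻ (λ a → ¬? (∈? _≟_ a (products k))) {xs = layer k} a∈new)) =
      x , k , x<M , ≤-refl , eq
    ... | inj₂ a∈old with x , i , x<M , i<k , eq ← products-representation k a∈old =
      x , i , x<M , m<n⇒m<1+n i<k , eq

    -- Each layer has M products, of which at most `collisions k` are dropped as old.
    products-length : ∀ k → k * M ≤ length (products k) + ∑ collisions k
    products-length zero    = z≤n
    products-length (suc k) = begin
      M + k * M                                                           ≤⟨ +-mono-≤ (filter-length M (λ x → suc x * y k)) (products-length k) ⟩
      length new + old + (length (products k) + ∑ collisions k)           ≤⟨ +-monoˡ-≤ _ (+-monoʳ-≤ (length new) old≤) ⟩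
      length new + collisions k + (length (products k) + ∑ collisions k)  ≡⟨ lem (length new) _ _ _ ⟩
      length new + length (products k) + (∑ collisions k + collisions k)  ≡⟨ cong (_+ ∑ collisions (suc k)) (length-++ new) ⟨
      length (products (suc k)) + ∑ collisions (suc k)                    ∎
      where
      open ≤-Reasoning
      lem : ∀ a b c d → a + b + (c + d) ≡ a + c + (d + b)
      lem = solve-∀
      old? : Decidable (_∈ products k)
      old? a = ∈? _≟_ a (products k)
      new = filter (λ a → ¬? (old? a)) (layer k)
      old = count (λ x → old? (suc x * y k)) M
      filter-length : ∀ M (f : ℕ → ℕ) → M ≤ length (filter (λ a → ¬? (old? a)) (applyUpTo f M)) + count (λ x → old? (f x)) M
      filter-length zero    f = z≤n
      filter-length (suc M) f rewrite ∑-split (λ x → 𝟙 (old? (f x))) 1 M with old? (f 0)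
      ... | yes _ = subst (suc M ≤_) (sym (+-suc _ _)) (s≤s (filter-length M (f ∘ suc)))
      ... | no  _ = s≤s (filter-length M (f ∘ suc))
      old≤ : old ≤ collisions k
      old≤ = begin
        old                                             ≤⟨ ∑-mono M (λ x _ → indicator x) ⟩
        ∑ (λ x → ∑ (λ i → 𝟙 (y i ∣? suc x * y k)) k) M  ≡⟨ ∑-swap (λ x i → 𝟙 (y i ∣? suc x * y k)) k M ⟩
        collisions k                                    ∎
        where
        indicator : ∀ x → 𝟙 (old? (suc x * y k)) ≤ ∑ (λ i → 𝟙 (y i ∣? suc x * y k)) k
        indicator x with old? (suc x * y k)
        ... | no  _ = z≤n
        ... | yes a∈ with x′ , i , _ , i<k , eq ← products-representation k a∈ = begin
          -- An old product equals some (x′ + 1) `y i` with i < k, so `y i` divides it.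
          1                                   ≡⟨ 𝟙-yes (y i ∣? suc x * y k) (divides (suc x′) eq) ⟨
          𝟙 (y i ∣? suc x * y k)              ≤⟨ ∑-term i<k ⟩
          ∑ (λ i → 𝟙 (y i ∣? suc x * y k)) k  ∎

-- Natural numbers in cuts

fromℕ-mono-< : ∀ {m n} → m < n → fromℕ m ℚ.< fromℕ n
fromℕ-mono-< m<n = ℚ.*<* (ℤ.*-monoʳ-<-pos ℤ.1ℤ (ℤ.+<+ m<n))

fromℕ-homo-^ : ∀ n k → fromℕ n ^ℚ k ≡ fromℕ (n ^ k)
fromℕ-homo-^ n zero    = refl
fromℕ-homo-^ n (suc k) = trans (cong (fromℕ n ℚ.*_) (fromℕ-homo-^ n k)) (sym (fromℕ-homo-* n (n ^ k)))

<⇒ofℕ∋ : ∀ {m n} → m < n → ofℕ n ∋ fromℕ m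
<⇒ofℕ∋ {n = n} m<n = inj₂ (fromℕ n , refl , fromℕ-mono-< m<n)

0ᵣ<ofℕ : ∀ n .{{_ : NonZero n}} → 0ᵣ <ᵣ ofℕ n
0ᵣ<ofℕ n = 0ℚ , 0∌0 , <⇒ofℕ∋ (>-nonZero⁻¹ n)
  where
  0∌0 : ¬ (0ᵣ ∋ 0ℚ)
  0∌0 (inj₁ 0<0)              = ℚ.<-irrefl refl 0<0
  0∌0 (inj₂ (_ , refl , 0<0)) = ℚ.<-irrefl refl 0<0

*ᵣ∋ : ∀ x y {a b p} → x ∋ fromℕ a → y ∋ fromℕ b → p ℚ.< fromℕ (a * b) → (x *ᵣ y) ∋ p
*ᵣ∋ x y {a} {b} a∈x b∈y p<ab = inj₂
  (fromℕ (a * b) , (fromℕ a , fromℕ b , 0≤fromℕ a , 0≤fromℕ b , a∈x , b∈y , fromℕ-homo-* a b) , p<ab)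

-- Natural witnesses in both cuts reduce the final estimates to inequalities in ℕ. No strictness is
-- lost here, since the cut of s holds only rationals below s.
ofℕ≤*ᵣ : ∀ x y {a b s} → x ∋ fromℕ a → y ∋ fromℕ b → s ≤ a * b → ofℕ s ≤ᵣ x *ᵣ y
ofℕ≤*ᵣ x y a∈x b∈y s≤ab (inj₁ p<0) = inj₁ p<0
ofℕ≤*ᵣ x y a∈x b∈y s≤ab (inj₂ (_ , refl , p<s)) = *ᵣ∋ x y a∈x b∈y (ℚ.<-≤-trans p<s (fromℕ-mono s≤ab))

-- A cut has no greatest element, whence r′ < r.
root∋ : ∀ {n a k r r′} → r′ < r → r ^ suc k ≤ n ^ a → (n ^[ a / suc k ]) ∋ fromℕ r′
root∋ {k = k} {r} r′<r rᵏ≤nᵃ = inj₂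
  (fromℕ r , (0≤fromℕ r , subst (ℚ._≤ _) (sym (fromℕ-homo-^ r (suc k))) (fromℕ-mono rᵏ≤nᵃ)) , fromℕ-mono-< r′<r)

-- Harmonic sums and the logarithm

sumℚ : (ℕ → ℚ) → ℕ → ℚ
sumℚ f k = foldr ℚ._+_ 0ℚ (applyUpTo f k)

sumℚ-split : ∀ f m n → sumℚ f (m + n) ≡ sumℚ f m ℚ.+ sumℚ (λ i → f (m + i)) n
sumℚ-split f zero    n = sym (ℚ.+-identityˡ _)
sumℚ-split f (suc m) n = trans (cong (f 0 ℚ.+_) (sumℚ-split (f ∘ suc) m n)) (sym (ℚ.+-assoc (f 0) _ _))

sumℚ≥ : ∀ c f n → (∀ i → i < n → c ℚ.≤ f i) → fromℕ n ℚ.* c ℚ.≤ sumℚ f n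
sumℚ≥ c f zero    c≤f = ℚ.≤-reflexive (ℚ.*-zeroˡ c)
sumℚ≥ c f (suc n) c≤f = begin
  fromℕ (suc n) ℚ.* c         ≡⟨ cong (ℚ._* c) (fromℕ-homo-+ 1 n) ⟩
  (1ℚ ℚ.+ fromℕ n) ℚ.* c      ≡⟨ ℚ.*-distribʳ-+ c 1ℚ (fromℕ n) ⟩
  1ℚ ℚ.* c ℚ.+ fromℕ n ℚ.* c  ≡⟨ cong (ℚ._+ fromℕ n ℚ.* c) (ℚ.*-identityˡ c) ⟩
  c ℚ.+ fromℕ n ℚ.* c         ≤⟨ ℚ.+-mono-≤ (c≤f 0 (s≤s z≤n)) (sumℚ≥ c (f ∘ suc) n λ i i<n → c≤f (suc i) (s≤s i<n)) ⟩
  sumℚ f (suc n)              ∎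
  where open ℚ.≤-Reasoning

unitFraction : ℕ → ℚ
unitFraction d = 1/ fromℕ (suc d)

unitFraction-antimono : ∀ {d e} → d ≤ e → unitFraction e ℚ.≤ unitFraction d
unitFraction-antimono d≤e = ℚ.*≤* (ℤ.*-monoˡ-≤-nonNeg ℤ.1ℤ (ℤ.+≤+ (s≤s d≤e)))

0≤unitFraction : ∀ d → 0ℚ ℚ.≤ unitFraction d
0≤unitFraction d = ℚ.nonNegative⁻¹ (unitFraction d)

-- At p this is 1/2 + 1/3 + ... + 1/(p + 1), the lower sum of log (p + 1) for unit intervals.
harmonic : ℕ → ℚ
harmonic = sumℚ (λ i → unitFraction (suc i))

-- The p + 1 terms 1/(p + 2), ..., 1/(2 p + 2) are all at least the last one, so they add up to at
-- least 1/2.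
harmonic-block : ∀ p → 1ℚ ℚ.≤ fromℕ 2 ℚ.* sumℚ (λ i → unitFraction (suc (p + i))) (suc p)
harmonic-block p = begin
  1ℚ                                                           ≡⟨ ℚ.*-inverseʳ (fromℕ (2 * suc p)) ⟨
  fromℕ (2 * suc p) ℚ.* c                                      ≡⟨ cong (ℚ._* c) (fromℕ-homo-* 2 (suc p)) ⟩
  fromℕ 2 ℚ.* fromℕ (suc p) ℚ.* c                              ≡⟨ ℚ.*-assoc (fromℕ 2) (fromℕ (suc p)) c ⟩
  fromℕ 2 ℚ.* (fromℕ (suc p) ℚ.* c)                            ≤⟨ ℚ.*-monoˡ-≤-nonNeg (fromℕ 2) (sumℚ≥ c _ (suc p) terms) ⟩
  fromℕ 2 ℚ.* sumℚ (λ i → unitFraction (suc (p + i))) (suc p)  ∎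
  where
  open ℚ.≤-Reasoning
  c = unitFraction (p + (suc p + 0))
  terms : ∀ i → i < suc p → c ℚ.≤ unitFraction (suc (p + i))
  terms i (s≤s i≤p) = unitFraction-antimono (subst (suc (p + i) ≤_) (sym (trans (cong (λ z → p + suc z) (+-identityʳ p)) (+-suc p p))) (s≤s (+-monoʳ-≤ p i≤p)))

-- The terms 1/2, ..., 1/2ᵏ form k dyadic blocks, each of sum at least 1/2.
harmonic-lower : ∀ k p → suc p ≡ 2 ^ k → fromℕ k ℚ.≤ fromℕ 2 ℚ.* harmonic p
harmonic-lower zero    zero refl = ℚ.≤-refl
harmonic-lower (suc k) p sp≡2ᵏ⁺¹ = begin
  fromℕ (suc k)                                ≡⟨ cong fromℕ (+-comm 1 k) ⟩
  fromℕ (k + 1)                                ≡⟨ fromℕ-homo-+ k 1 ⟩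
  fromℕ k ℚ.+ 1ℚ                               ≤⟨ ℚ.+-mono-≤ (harmonic-lower k r sr≡2ᵏ) (harmonic-block r) ⟩
  fromℕ 2 ℚ.* harmonic r ℚ.+ fromℕ 2 ℚ.* tail  ≡⟨ ℚ.*-distribˡ-+ (fromℕ 2) (harmonic r) tail ⟨
  fromℕ 2 ℚ.* (harmonic r ℚ.+ tail)            ≡⟨ cong (fromℕ 2 ℚ.*_) (sumℚ-split (λ i → unitFraction (suc i)) r (suc r)) ⟨
  fromℕ 2 ℚ.* harmonic (r + suc r)             ≡⟨ cong (λ z → fromℕ 2 ℚ.* harmonic z) (suc-injective eq) ⟩
  fromℕ 2 ℚ.* harmonic p                       ∎
  where
  open ℚ.≤-Reasoning
  r = pred (2 ^ k)
  sr≡2ᵏ : suc r ≡ 2 ^ k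
  sr≡2ᵏ = suc-pred (2 ^ k) {{m^n≢0 2 k}}
  tail = sumℚ (λ i → unitFraction (suc (r + i))) (suc r)
  eq : suc (r + suc r) ≡ suc p
  eq = trans (cong (suc r +_) (sym (+-identityʳ (suc r)))) (trans (cong (2 *_) sr≡2ᵏ) (sym sp≡2ᵏ⁺¹))

harmonic-mono : ∀ {m n} → m ≤ n → harmonic m ℚ.≤ harmonic n
harmonic-mono {m} m≤n with t , refl ← m≤n⇒∃[o]m+o≡n m≤n = begin
  harmonic m                                                ≡⟨ ℚ.+-identityʳ (harmonic m) ⟨
  harmonic m ℚ.+ 0ℚ                                         ≡⟨ cong (harmonic m ℚ.+_) (ℚ.*-zeroʳ (fromℕ t)) ⟨
  harmonic m ℚ.+ fromℕ t ℚ.* 0ℚ                             ≤⟨ ℚ.+-monoʳ-≤ (harmonic m) (sumℚ≥ 0ℚ _ t λ i _ → 0≤unitFraction (suc (m + i))) ⟩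
  harmonic m ℚ.+ sumℚ (λ i → unitFraction (suc (m + i))) t  ≡⟨ sumℚ-split (λ i → unitFraction (suc i)) m t ⟨
  harmonic (m + t)                                          ∎
  where open ℚ.≤-Reasoning

-- The lower sum for unit intervals is already at least k / 2 > l.
log∋ : ∀ {n k l} → 2 ^ k ≤ n → 2 * l < k → log n ∋ fromℕ l
log∋ {n} {k} {l} 2ᵏ≤n 2l<k = inj₂ (logSum n 1 , (1 , refl) ,
  ℚ.*-cancelˡ-<-nonNeg (fromℕ 2) (begin-strict
    fromℕ 2 ℚ.* fromℕ l                  ≡⟨ fromℕ-homo-* 2 l ⟨
    fromℕ (2 * l)                        <⟨ fromℕ-mono-< 2l<k ⟩
    fromℕ k                              ≤⟨ harmonic-lower k (pred (2 ^ k)) (suc-pred (2 ^ k) {{m^n≢0 2 k}}) ⟩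
    fromℕ 2 ℚ.* harmonic (pred (2 ^ k))  ≤⟨ ℚ.*-monoˡ-≤-nonNeg (fromℕ 2) (harmonic-mono (pred-mono-≤ 2ᵏ≤n)) ⟩
    fromℕ 2 ℚ.* harmonic (pred n)        ≡⟨ cong (λ z → fromℕ 2 ℚ.* harmonic z) (*-identityʳ (pred n)) ⟨
    fromℕ 2 ℚ.* logSum n 1               ∎))
  where open ℚ.≤-Reasoning

-- Choice of the parameters

n<2^n : ∀ n → n < 2 ^ n
n<2^n zero    = s≤s z≤n
n<2^n (suc n) = begin
  suc (suc n)          ≤⟨ s≤s (n<2^n n) ⟩
  1 + 2 ^ n            ≤⟨ +-mono-≤ (m^n>0 2 n) (m≤m+n (2 ^ n) 0) ⟩
  2 ^ n + (2 ^ n + 0)  ∎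
  where open ≤-Reasoning

square-cancel-≤ : ∀ {m n} → m * m ≤ n * n → m ≤ n
square-cancel-≤ m²≤n² = ≮⇒≥ λ n<m → ≤⇒≯ m²≤n² (*-mono-< n<m n<m)

module Construction (N : ℕ) where

  -- An even m makes n = (2 u)² a square. Then |A| will be of order u⁶, with u³ and u⁴ as integral
  -- substitutes for |A|^(1/2) and |A|^(2/3).
  l m n q M u : ℕ
  l = suc N
  m = 2 * l
  n = 2 ^ m
  q = 2 * suc m
  M = n * n
  u = 2 ^ N

  open Progression q n

  A = products M n

  representation : ∀ {a} → a ∈ A → ∃[ x ] ∃[ k ] x < M × k < n × a ≡ suc x * y k
  representation = products-representation M n

  A-Unique : Unique A
  A-Unique = products-Unique M n

  A-bounded : ∀ {a} → a ∈ A → NonZero a × a ≤ M * (q * (2 * n))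
  A-bounded a∈ with x , k , x<M , k<n , refl ← representation a∈ = _ , *-mono-≤ x<M (y≤2qn k<n)

  A-NonZero : All NonZero A
  A-NonZero = All.tabulate (proj₁ ∘ A-bounded)

  n≡4u² : n ≡ 4 * (u * u)
  n≡4u² = trans (^-distribˡ-+-* 2 l (l + 0)) (trans (cong (λ z → 2 ^ l * 2 ^ z) (+-identityʳ l)) (lem u))
    where
    lem : ∀ u → 2 * u * (2 * u) ≡ 4 * (u * u)
    lem = solve-∀

  -- The choice q = 2 (m + 1) cancels the factor m + 1 of the collision bound and leaves one half.
  few-collisions : 2 * ∑ (collisions M) n ≤ n * M
  few-collisions = *-cancelˡ-≤ (suc m) (begin
    suc m * (2 * ∑ (collisions M) n)  ≡⟨ lem (suc m) (∑ (collisions M) n) ⟩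
    q * ∑ (collisions M) n            ≤⟨ total-collisions-bound M m refl ⟩
    M * (suc m * n)                   ≡⟨ lem′ M (suc m) n ⟩
    suc m * (n * M)                   ∎)
    where
    open ≤-Reasoning
    lem : ∀ m c → m * (2 * c) ≡ 2 * m * c
    lem = solve-∀
    lem′ : ∀ M m n → M * (m * n) ≡ m * (n * M)
    lem′ = solve-∀

  -- Half of the n M = 64 u⁶ products survive.
  A-large : 32 * u ^ 6 ≤ length A
  A-large = *-cancelˡ-≤ 2 (+-cancelʳ-≤ (n * M) _ _ (begin
    2 * (32 * u ^ 6) + n * M               ≡⟨ cong (_+ n * M) (trans (lem u) (sym (cong (λ n → n * (n * n)) n≡4u²))) ⟩
    n * M + n * M                          ≡⟨ cong (n * M +_) (+-identityʳ (n * M)) ⟨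
    2 * (n * M)                            ≤⟨ *-monoʳ-≤ 2 (products-length M n) ⟩
    2 * (length A + ∑ (collisions M) n)    ≡⟨ *-distribˡ-+ 2 (length A) _ ⟩
    2 * length A + 2 * ∑ (collisions M) n  ≤⟨ +-monoʳ-≤ (2 * length A) few-collisions ⟩
    2 * length A + n * M                   ∎))
    where
    open ≤-Reasoning
    lem : ∀ u → 2 * (32 * (u * (u * (u * (u * (u * (u * 1))))))) ≡ 4 * (u * u) * (4 * (u * u) * (4 * (u * u)))
    lem = solve-∀

  -- The last inequality is 3 + 2 N ≤ 4 (1 + N)².
  s₊≤ : s₊ A ≤ 64 * (u ^ 3 * l)
  s₊≤ = maxSidon≤ _+_ A-Unique λ {S} uS S⊆A sidon → square-cancel-≤ (begin
    length S * length S                                     ≤⟨ additive-Sidon-bound uS (All.tabulate (A-bounded ∘ S⊆A)) sidon ⟩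
    4 * (n * n * (2 * suc m * (2 * n)))                     ≡⟨ cong (λ n → 4 * (n * n * (2 * suc m * (2 * n)))) n≡4u² ⟩
    4 * (n′ * n′ * (2 * suc m * (2 * n′)))                  ≡⟨ lem u N ⟩
    1024 * u ^ 6 * (3 + 2 * N)                              ≤⟨ *-monoʳ-≤ (1024 * u ^ 6) (m≤m+n (3 + 2 * N) (1 + 6 * N + 4 * (N * N))) ⟩
    1024 * u ^ 6 * (3 + 2 * N + (1 + 6 * N + 4 * (N * N)))  ≡⟨ lem′ u N ⟩
    64 * (u ^ 3 * l) * (64 * (u ^ 3 * l))                   ∎)
    where
    open ≤-Reasoning
    n′ = 4 * (u * u)
    lem : ∀ u N → 4 * (4 * (u * u) * (4 * (u * u)) * (2 * (1 + (1 + N + (1 + N + 0))) * (2 * (4 * (u * u))))) ≡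
                  1024 * (u * (u * (u * (u * (u * (u * 1)))))) * (3 + 2 * N)
    lem = solve-∀
    lem′ : ∀ u N → 1024 * (u * (u * (u * (u * (u * (u * 1)))))) * (3 + 2 * N + (1 + 6 * N + 4 * (N * N))) ≡
                   64 * (u * (u * (u * 1)) * (1 + N)) * (64 * (u * (u * (u * 1)) * (1 + N)))
    lem′ = solve-∀

  -- The logarithmic factor l = N + 1 is absorbed by u = 2ᴺ; this serves the bound on the maximum.
  s₊≤′ : s₊ A ≤ 64 * u ^ 4
  s₊≤′ = begin
    s₊ A              ≤⟨ s₊≤ ⟩
    64 * (u ^ 3 * l)  ≤⟨ *-monoʳ-≤ 64 (*-monoʳ-≤ (u ^ 3) (n<2^n N)) ⟩
    64 * (u ^ 3 * u)  ≡⟨ cong (64 *_) (*-comm (u ^ 3) u) ⟩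
    64 * u ^ 4        ∎
    where open ≤-Reasoning

  s⁎≤ : s⁎ A ≤ 32 * u ^ 4
  s⁎≤ = begin
    s⁎ A               ≤⟨ maxSidon≤ _*_ A-Unique (λ uS S⊆A → multiplicative-Sidon-bound y (λ _ → _) y-injective uS (All.tabulate (representation ∘ S⊆A))) ⟩
    n * n + n * n      ≡⟨ cong (λ n → n * n + n * n) n≡4u² ⟩
    n′ * n′ + n′ * n′  ≡⟨ lem u ⟩
    32 * u ^ 4         ∎
    where
    open ≤-Reasoning
    n′ = 4 * (u * u)
    lem : ∀ u → 4 * (u * u) * (4 * (u * u)) + 4 * (u * u) * (4 * (u * u)) ≡ 32 * (u * (u * (u * (u * 1))))
    lem = solve-∀

  A-exponential : 2 ^ (5 + N * 6) ≤ length A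
  A-exponential = begin
    2 ^ (5 + N * 6)   ≡⟨ ^-distribˡ-+-* 2 5 (N * 6) ⟩
    32 * 2 ^ (N * 6)  ≡⟨ cong (32 *_) (^-*-assoc 2 N 6) ⟨
    32 * u ^ 6        ≤⟨ A-large ⟩
    length A          ∎
    where open ≤-Reasoning

  N≤length : N ≤ length A
  N≤length = begin
    N                ≤⟨ <⇒≤ (n<2^n N) ⟩
    2 ^ N            ≤⟨ ^-monoʳ-≤ 2 (≤-trans (m≤m*n N 6) (m≤n+m (N * 6) 5)) ⟩
    2 ^ (5 + N * 6)  ≤⟨ A-exponential ⟩
    length A         ∎
    where open ≤-Reasoning

  instance
    u≢0 : NonZero u
    u≢0 = m^n≢0 2 N

  √A∋ : (length A ^[ 1 / 2 ]) ∋ fromℕ (4 * u ^ 3)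
  -- 5² = 25 ≤ 32, and 4 < 5 provides the strict inequality.
  √A∋ = root∋ {length A} {1} {1} (*-monoˡ-< (u ^ 3) {{m^n≢0 u 3}} {4} {5} ≤-refl) (begin
    (5 * u ^ 3) ^ 2  ≡⟨ lem u ⟩
    25 * u ^ 6       ≤⟨ *-monoˡ-≤ (u ^ 6) {25} {32} (m≤m+n 25 7) ⟩
    32 * u ^ 6       ≤⟨ A-large ⟩
    length A         ≡⟨ *-identityʳ (length A) ⟨
    length A ^ 1     ∎)
    where
    open ≤-Reasoning
    lem : ∀ u → 5 * (u * (u * (u * 1))) * (5 * (u * (u * (u * 1))) * 1) ≡ 25 * (u * (u * (u * (u * (u * (u * 1))))))
    lem = solve-∀

  ∛A²∋ : (length A ^[ 2 / 3 ]) ∋ fromℕ (8 * u ^ 4)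
  -- 10³ = 1000 ≤ 32²; the smaller 8 is taken because it divides the constants 32 and 64.
  ∛A²∋ = root∋ {length A} {2} {2} (*-monoˡ-< (u ^ 4) {{m^n≢0 u 4}} {8} {10} (m≤m+n 9 1)) (begin
    (10 * u ^ 4) ^ 3        ≡⟨ lem u ⟩
    1000 * (u ^ 6 * u ^ 6)  ≤⟨ *-monoˡ-≤ (u ^ 6 * u ^ 6) {1000} {1024} (m≤m+n 1000 24) ⟩
    1024 * (u ^ 6 * u ^ 6)  ≡⟨ lem′ (u ^ 6) ⟩
    (32 * u ^ 6) ^ 2        ≤⟨ ^-monoˡ-≤ 2 A-large ⟩
    length A ^ 2            ∎)
    where
    open ≤-Reasoning
    lem : ∀ u → (let v = 10 * (u * (u * (u * (u * 1)))) in v * (v * (v * 1))) ≡ 1000 * ((u * (u * (u * (u * (u * (u * 1)))))) * (u * (u * (u * (u * (u * (u * 1)))))))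
    lem = solve-∀
    lem′ : ∀ v → 1024 * (v * v) ≡ 32 * v * (32 * v * 1)
    lem′ = solve-∀

  log∋2l : log (length A) ∋ fromℕ (2 * l)
  log∋2l = log∋ A-exponential (subst (2 * (2 * l) <_) (lem N) (m≤m+n (suc (2 * (2 * l))) (2 * N)))
    where
    lem : ∀ N → suc (2 * (2 * (1 + N))) + 2 * N ≡ 5 + N * 6
    lem = solve-∀

  s₊-bound : ofℕ (s₊ A) ≤ᵣ ofℕ 17 *ᵣ (length A ^[ 1 / 2 ] *ᵣ log (length A))
  -- 64 = 16 · 4, with 16 in the cut of 17. The witness 2 l for the logarithm leaves 4 u³ l strictly
  -- below the product 4 u³ · 2 l.
  s₊-bound = ofℕ≤*ᵣ (ofℕ 17) (length A ^[ 1 / 2 ] *ᵣ log (length A)) (<⇒ofℕ∋ (n<1+n 16))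
    (*ᵣ∋ (length A ^[ 1 / 2 ]) (log (length A)) √A∋ log∋2l
      (fromℕ-mono-< (*-monoʳ-< (4 * u ^ 3) {{m*n≢0 4 _ {{_}} {{m^n≢0 u 3}}}} (m<m+n l {l + 0} (s≤s z≤n)))))
    (≤-trans s₊≤ (≤-reflexive (lem (u ^ 3) l)))
    where
    lem : ∀ v l → 64 * (v * l) ≡ 16 * (4 * v * l)
    lem = solve-∀

  s⁎-bound : ofℕ (s⁎ A) ≤ᵣ ofℕ 5 *ᵣ length A ^[ 2 / 3 ]
  s⁎-bound = ofℕ≤*ᵣ (ofℕ 5) (length A ^[ 2 / 3 ]) (<⇒ofℕ∋ (n<1+n 4)) ∛A²∋
    (≤-trans s⁎≤ (≤-reflexive (*-assoc 4 8 (u ^ 4))))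

  max-bound : ofℕ (s₊ A ⊔ s⁎ A) ≤ᵣ ofℕ 9 *ᵣ length A ^[ 2 / 3 ]
  max-bound = ofℕ≤*ᵣ (ofℕ 9) (length A ^[ 2 / 3 ]) (<⇒ofℕ∋ (n<1+n 8)) ∛A²∋
    (≤-trans (⊔-lub s₊≤′ (≤-trans s⁎≤ (*-monoˡ-≤ (u ^ 4) {32} {64} (m≤m+n 32 32))))
      (≤-reflexive (*-assoc 8 8 (u ^ 4))))

theorem1p2 : ∃[ C₁ ] ∃[ C₂ ] ∃[ C₃ ] 0ᵣ <ᵣ C₁ × 0ᵣ <ᵣ C₂ × 0ᵣ <ᵣ C₃ ×
    (∀ N → ∃[ A ] Unique A × All NonZero A × N ≤ length A ×
    ofℕ (s₊ A) ≤ᵣ C₁ *ᵣ (length A ^[ 1 / 2 ] *ᵣ log (length A)) ×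
    ofℕ (s⁎ A) ≤ᵣ C₂ *ᵣ length A ^[ 2 / 3 ] ×
    ofℕ (s₊ A ⊔ s⁎ A) ≤ᵣ C₃ *ᵣ length A ^[ 2 / 3 ])
theorem1p2 = ofℕ 17 , ofℕ 5 , ofℕ 9 , 0ᵣ<ofℕ 17 , 0ᵣ<ofℕ 5 , 0ᵣ<ofℕ 9 , λ N →
  let open Construction N in
  A , A-Unique , A-NonZero , N≤length , s₊-bound , s⁎-bound , max-bound
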